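{- Let $\lambda\in\mathbb Z^n$ be a partition, let $v\in\lambda B_n$, and let $T$ be the tableau obtained by adding the column with entries $1,2,\dots,n$ (top to bottom) to the left of the key tableau $K(v)$. Then the window notation of the minimal length coset representative $\sigma_v$ is given by the column reading word of $T$, where entries with the same absolute value are read just once (at their first occurrence).
   Context: Fix $n\ge1$ and let $[\pm n]=\{1<\dots<n<\overline n<\dots<\overline1\}$, where $\overline i=-i$. $B_n$ is the hyperoctahedral group with Coxeter generators $s_1,\dots,s_n$ (with $(s_is_{i+1})^3=1$ for $1\le i\le n-2$, $(s_{n-1}s_n)^4=1$, and the other pairs commuting), seen as the group of odd bijections of $[\pm n]$, acting on the right (so products are composed from left to right), $s_i$ ($i<n$) exchanging $i$ and $i+1$, and $s_n$ exchanging $n$ and $\overline n$. The window notation of $\sigma$ is $[a_1\,a_2\dots a_n]$, $a_i=(i)\sigma$. $B_n$ acts on the right on $\mathbb Z^n$: $vs_i$ swaps the $i$-th and $(i+1)$-th entries of $v$ if $i<n$, and $vs_n$ changes the sign of the last entry. A partition is $\lambda\in\mathbb Z^n$ with $\lambda_1\ge\dots\ge\lambda_n\ge0$; $\lambda B_n$ is its orbit and $W_\lambda$ its stabilizer. For $v\in\lambda B_n$, $\sigma_v$ is the minimal length element of the right coset $\{\sigma\in B_n:\lambda\sigma=v\}$ of $W_\lambda$. For $v\in\mathbb Z^n$, $K(v)$ is the tableau whose columns are obtained by putting, for each $i\in[n]$, in the first $|v_i|$ columns the letter $i$ if $v_i>0$, or $\overline i$ if $v_i<0$; each column is sorted increasingly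 from top to bottom in the order of $[\pm n]$. The column reading word of a tableau is obtained by reading down columns, columns from right to left. For example, for $v=(3,\overline3,0,0,\overline2)$ one gets $\sigma_v=[1\,\overline2\,\overline5\,3\,4]$. -}

module Defs where

open import Algebra.Bundles using (Group)
open import Algebra.Structures using (IsGroup)
open import Data.Bool.Base using (true; false; if_then_else_)
open import Data.Fin.Base as Fin using (Fin; suc; inject₁; fromℕ)
import Data.Fin.Properties as Fin
open import Data.Fin.Permutation.Components using (transpose; transpose-inverse)
open import Data.Integer.Base as ℤ using (ℤ; 0ℤ; +0; +[1+_]; -[1+_]; ∣_∣)
import Data.Integer.Properties as ℤ
open import Data.List.Base
  using (List; []; _∷_; length; map; filter; foldr; foldl; concat; reverse;
         tabulate; applyUpTo; allFin; deduplicate)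
open import Data.Nat.Base as ℕ using (ℕ; suc)
import Data.Nat.Properties as ℕ
open import Data.Product.Base using (_×_; _,_; Σ; ∃-syntax)
open import Data.Sum.Base using (inj₁; inj₂)
open import Data.Vec.Functional as Vector using (Vector; updateAt)
open import Data.Vec.Functional.Properties using (updateAt-updates; updateAt-minimal)
open import Function.Base using (_∘_)
open import Function.Bundles using (_↔_; Inverse; mk↔ₛ′)
open import Function.Construct.Composition using (_↔-∘_)
open import Function.Construct.Identity using (↔-id)
open import Function.Construct.Symmetry using (↔-sym)
open import Level using (0ℓ)
open import Relation.Binary.Bundles using (DecTotalOrder)
open import Relation.Binary.Definitions using (Total; Decidable; DecidableEquality)
open import Relation.Binary.PropositionalEquality
open import Relation.Nullary using (does; yes; no)
open import Relation.Nullary.Decidable using (map′)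

private
  variable
    m n : ℕ

------------------------------------------------------------------------
-- The alphabet [±n]

-- `pos i` and `neg i` are the letters i + 1 and its opposite, as Fin counts
-- from zero.
data Letter (n : ℕ) : Set where
  pos : Fin n → Letter n
  neg : Fin n → Letter n

bar : Letter n → Letter n
bar (pos i) = neg i
bar (neg i) = pos i

bar-involutive : (x : Letter n) → bar (bar x) ≡ x
bar-involutive (pos i) = refl
bar-involutive (neg i) = refl

abs : Letter n → Fin n
abs (pos i) = i
abs (neg i) = i

-- 1 < … < n < n̅ < … < 1̅
infix 4 _≼_
data _≼_ {n : ℕ} : Letter n → Letter n → Set where
  pos≼pos : ∀ {i j} → i Fin.≤ j → pos i ≼ pos j
  pos≼neg : ∀ {i j} → pos i ≼ neg j
  neg≼neg : ∀ {i j} → j Fin.≤ i → neg i ≼ neg j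

≼-reflexive : {x y : Letter n} → x ≡ y → x ≼ y
≼-reflexive {x = pos i} refl = pos≼pos ℕ.≤-refl
≼-reflexive {x = neg i} refl = neg≼neg ℕ.≤-refl

≼-trans : {x y z : Letter n} → x ≼ y → y ≼ z → x ≼ z
≼-trans (pos≼pos p) (pos≼pos q) = pos≼pos (ℕ.≤-trans p q)
≼-trans (pos≼pos p) pos≼neg     = pos≼neg
≼-trans pos≼neg     (neg≼neg q) = pos≼neg
≼-trans (neg≼neg p) (neg≼neg q) = neg≼neg (ℕ.≤-trans q p)

≼-antisym : {x y : Letter n} → x ≼ y → y ≼ x → x ≡ y
≼-antisym (pos≼pos p) (pos≼pos q) = cong pos (Fin.≤-antisym p q)
≼-antisym (neg≼neg p) (neg≼neg q) = cong neg (Fin.≤-antisym q p)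

≼-total : Total (_≼_ {n})
≼-total (pos i) (pos j) with Fin.≤-total i j
... | inj₁ p = inj₁ (pos≼pos p)
... | inj₂ p = inj₂ (pos≼pos p)
≼-total (pos i) (neg j) = inj₁ pos≼neg
≼-total (neg i) (pos j) = inj₂ pos≼neg
≼-total (neg i) (neg j) with Fin.≤-total i j
... | inj₁ p = inj₂ (neg≼neg p)
... | inj₂ p = inj₁ (neg≼neg p)

infix 4 _≼?_ _≟_
_≼?_ : Decidable (_≼_ {n})
pos i ≼? pos j = map′ pos≼pos (λ { (pos≼pos p) → p }) (i Fin.≤? j)
pos i ≼? neg j = yes pos≼neg
neg i ≼? pos j = no λ ()
neg i ≼? neg j = map′ neg≼neg (λ { (neg≼neg p) → p }) (j Fin.≤? i)

_≟_ : DecidableEquality (Letter n)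
pos i ≟ pos j = map′ (cong pos) (λ { refl → refl }) (i Fin.≟ j)
pos i ≟ neg j = no λ ()
neg i ≟ pos j = no λ ()
neg i ≟ neg j = map′ (cong neg) (λ { refl → refl }) (i Fin.≟ j)

≼-decTotalOrder : ℕ → DecTotalOrder 0ℓ 0ℓ 0ℓ
≼-decTotalOrder n = record
  { Carrier         = Letter n
  ; _≈_             = _≡_
  ; _≤_             = _≼_
  ; isDecTotalOrder = record
    { isTotalOrder = record
      { isPartialOrder = record
        { isPreorder = record
          { isEquivalence = isEquivalence
          ; reflexive     = ≼-reflexive
          ; trans         = ≼-trans
          }
        ; antisym    = ≼-antisym
        }
      ; total          = ≼-total
      }
    ; _≟_          = _≟_
    ; _≤?_         = _≼?_
    }
  }

------------------------------------------------------------------------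
-- The hyperoctahedral group

record SignedPerm (n : ℕ) : Set where
  field
    bijection : Letter n ↔ Letter n

  open Inverse bijection public using (to; from; strictlyInverseˡ; strictlyInverseʳ)

  field
    odd : ∀ x → to (bar x) ≡ bar (to x)

  from-odd : ∀ x → from (bar x) ≡ bar (from x)
  from-odd x = begin
    from (bar x)              ≡⟨ cong (from ∘ bar) (strictlyInverseˡ x) ⟨
    from (bar (to (from x)))  ≡⟨ cong from (odd (from x)) ⟨
    from (to (bar (from x)))  ≡⟨ strictlyInverseʳ (bar (from x)) ⟩
    bar (from x)              ∎
    where open ≡-Reasoning

open SignedPerm using (to; from; strictlyInverseˡ; strictlyInverseʳ; odd; from-odd)

infix 4 _≈_
_≈_ : SignedPerm n → SignedPerm n → Set
σ ≈ τ = to σ ≗ to τ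

-- Permutations act on the right, so σ ∙ τ applies σ first.
infixl 7 _∙_
_∙_ : SignedPerm n → SignedPerm n → SignedPerm n
σ ∙ τ = record
  { bijection = SignedPerm.bijection τ ↔-∘ SignedPerm.bijection σ
  ; odd       = λ x → trans (cong (to τ) (odd σ x)) (odd τ (to σ x))
  }

ε : SignedPerm n
ε = record { bijection = ↔-id _ ; odd = λ _ → refl }

infix 8 _⁻¹
_⁻¹ : SignedPerm n → SignedPerm n
σ ⁻¹ = record
  { bijection = ↔-sym (SignedPerm.bijection σ)
  ; odd       = from-odd σ
  }

from-cong : {σ τ : SignedPerm n} → σ ≈ τ → from σ ≗ from τ
from-cong {σ = σ} {τ} σ≈τ x = begin
  from σ x                    ≡⟨ cong (from σ) (strictlyInverseˡ τ x) ⟨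
  from σ (to τ (from τ x))    ≡⟨ cong (from σ) (σ≈τ (from τ x)) ⟨
  from σ (to σ (from τ x))    ≡⟨ strictlyInverseʳ σ (from τ x) ⟩
  from τ x                    ∎
  where open ≡-Reasoning

B-isGroup : IsGroup (_≈_ {n}) _∙_ ε _⁻¹
B-isGroup = record
  { isMonoid = record
    { isSemigroup = record
      { isMagma = record
        { isEquivalence = record
          { refl  = λ _ → refl
          ; sym   = λ p x → sym (p x)
          ; trans = λ p q x → trans (p x) (q x)
          }
        ; ∙-cong = λ {_} {_} {_} {ρ} p q x → trans (q _) (cong (to ρ) (p x))
        }
      ; assoc   = λ _ _ _ _ → refl
      }
    ; identity    = (λ _ _ → refl) , (λ _ _ → refl)
    }
  ; inverse  = strictlyInverseˡ , strictlyInverseʳ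
  ; ⁻¹-cong  = λ {σ} {τ} → from-cong {σ = σ} {τ}
  }

B : ℕ → Group 0ℓ 0ℓ
B n = record { isGroup = B-isGroup {n} }

-- For B (suc m), `adjacent i` is s₍ᵢ₊₁₎ and `final` is s₍ₘ₊₁₎.
data Generator : ℕ → Set where
  adjacent : Fin m → Generator (suc m)
  final    : Generator (suc m)

flipAt : Fin n → Letter n → Letter n
flipAt k x = if does (abs x Fin.≟ k) then bar x else x

transposeLetter : Fin n → Fin n → Letter n → Letter n
transposeLetter j k (pos i) = pos (transpose j k i)
transposeLetter j k (neg i) = neg (transpose j k i)

flipAt-bar : (k : Fin n) (x : Letter n) → flipAt k (bar x) ≡ bar (flipAt k x)
flipAt-bar k (pos i) with does (i Fin.≟ k)
... | true  = refl
... | false = refl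
flipAt-bar k (neg i) with does (i Fin.≟ k)
... | true  = refl
... | false = refl

flipAt-involutive : (k : Fin n) (x : Letter n) → flipAt k (flipAt k x) ≡ x
flipAt-involutive k (pos i) with does (i Fin.≟ k) in eq
... | true  rewrite eq = refl
... | false rewrite eq = refl
flipAt-involutive k (neg i) with does (i Fin.≟ k) in eq
... | true  rewrite eq = refl
... | false rewrite eq = refl

transposeLetter-bar : (j k : Fin n) (x : Letter n) →
                      transposeLetter j k (bar x) ≡ bar (transposeLetter j k x)
transposeLetter-bar j k (pos i) = refl
transposeLetter-bar j k (neg i) = refl

transposeLetter-inverse : (j k : Fin n) (x : Letter n) →
                          transposeLetter j k (transposeLetter k j x) ≡ x
transposeLetter-inverse j k (pos i) = cong pos (transpose-inverse j k)
transposeLetter-inverse j k (neg i) = cong neg (transpose-inverse j k)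

s : Generator n → SignedPerm n
s (adjacent i) = record
  { bijection = mk↔ₛ′ (transposeLetter (inject₁ i) (suc i))
                      (transposeLetter (suc i) (inject₁ i))
                      (transposeLetter-inverse (inject₁ i) (suc i))
                      (transposeLetter-inverse (suc i) (inject₁ i))
  ; odd       = transposeLetter-bar (inject₁ i) (suc i)
  }
s {suc m} final = record
  { bijection = mk↔ₛ′ (flipAt (fromℕ m)) (flipAt (fromℕ m))
                      (flipAt-involutive (fromℕ m)) (flipAt-involutive (fromℕ m))
  ; odd       = flipAt-bar (fromℕ m)
  }

evaluate : List (Generator n) → SignedPerm n
evaluate = foldr (λ g σ → s g ∙ σ) ε

HasLength : SignedPerm n → ℕ → Set
HasLength {n} σ k =
  (∃[ w ] length w ≡ k × evaluate w ≈ σ) ×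
  ((w : List (Generator n)) → evaluate w ≈ σ → k ℕ.≤ length w)

window : SignedPerm n → List (Letter n)
window σ = tabulate (λ i → to σ (pos i))

------------------------------------------------------------------------
-- The right action on ℤⁿ

infixl 7 _▹_ _·_
_▹_ : Vector ℤ n → Generator n → Vector ℤ n
v ▹ adjacent i        = v ∘ transpose (inject₁ i) (suc i)
_▹_ {suc m} v final = updateAt v (fromℕ m) (λ a → ℤ.- a)

entry : Vector ℤ n → Letter n → ℤ
entry v (pos i) = v i
entry v (neg i) = ℤ.- v i

-- With v indexed by letters through v₋ᵢ = - vᵢ, the action is determined by
-- (v · σ)₍ᵢ₎σ = vᵢ.  The lemmas below say that it is a right action of the
-- group and extends _▹_.
_·_ : Vector ℤ n → SignedPerm n → Vector ℤ n
(v · σ) i = entry v (from σ (pos i))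

entry-bar : (v : Vector ℤ n) (x : Letter n) → entry v (bar x) ≡ ℤ.- entry v x
entry-bar v (pos i) = refl
entry-bar v (neg i) = sym (ℤ.neg-involutive (v i))

entry-· : (v : Vector ℤ n) (σ : SignedPerm n) (x : Letter n) →
          entry (v · σ) x ≡ entry v (from σ x)
entry-· v σ (pos i) = refl
entry-· v σ (neg i) = sym (trans (cong (entry v) (from-odd σ (pos i)))
                                 (entry-bar v (from σ (pos i))))

·-cong : {v w : Vector ℤ n} {σ τ : SignedPerm n} →
         v ≗ w → σ ≈ τ → v · σ ≗ w · τ
·-cong {v = v} {w} {σ} {τ} v≗w σ≈τ i =
  trans (entry-cong (from σ (pos i)))
        (cong (entry w) (from-cong {σ = σ} {τ} σ≈τ (pos i)))
  where
  entry-cong : ∀ x → entry v x ≡ entry w x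
  entry-cong (pos j) = v≗w j
  entry-cong (neg j) = cong ℤ.-_ (v≗w j)

·-ε : (v : Vector ℤ n) → v · ε ≗ v
·-ε v i = refl

·-∙ : (v : Vector ℤ n) (σ τ : SignedPerm n) → v · (σ ∙ τ) ≗ v · σ · τ
·-∙ v σ τ i = sym (entry-· v σ (from τ (pos i)))

transpose-comm : (i j k : Fin n) → transpose i j k ≡ transpose j i k
transpose-comm i j k with k Fin.≟ i in p | k Fin.≟ j in q
... | yes refl | yes refl = refl
... | yes _    | no  _    rewrite p = refl
... | no  _    | yes _    rewrite q = refl
... | no  _    | no  _    rewrite p | q = refl

·-s : (v : Vector ℤ n) (g : Generator n) → v · s g ≗ v ▹ g
·-s v (adjacent i) j = cong v (transpose-comm (suc i) (inject₁ i) j)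
·-s {suc m} v final j with j Fin.≟ fromℕ m
... | yes refl = sym (updateAt-updates (fromℕ m) v)
... | no  j≢m  = sym (updateAt-minimal j (fromℕ m) v j≢m)

·-evaluate : (v : Vector ℤ n) (w : List (Generator n)) →
             v · evaluate w ≗ foldl _▹_ v w
·-evaluate v []      i = refl
·-evaluate v (g ∷ w) i =
  trans (·-∙ v (s g) (evaluate w) i)
  (trans (·-cong {σ = evaluate w} {τ = evaluate w} (·-s v g) (λ _ → refl) i)
         (·-evaluate (v ▹ g) w i))

record IsPartition (v : Vector ℤ n) : Set where
  field
    decreasing  : ∀ {i j} → i Fin.≤ j → v j ℤ.≤ v i
    nonNegative : ∀ i → 0ℤ ℤ.≤ v i

InOrbit : Vector ℤ n → Vector ℤ n → Set
InOrbit {n} v u = Σ (SignedPerm n) λ σ → v · σ ≗ u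

-- σ is an element of least length of the coset {τ ∣ v · τ = u}.
IsMinimalRepresentative : (v u : Vector ℤ n) → SignedPerm n → Set
IsMinimalRepresentative v u σ =
  v · σ ≗ u ×
  ∃[ k ] HasLength σ k × (∀ τ l → v · τ ≗ u → HasLength τ l → k ℕ.≤ l)

------------------------------------------------------------------------
-- Key tableaux and reading words

-- Each column from top to bottom, columns from left to right.
Tableau : ℕ → Set
Tableau n = List (List (Letter n))

-- Only used for vᵢ ≠ 0.
letter : Vector ℤ n → Fin n → Letter n
letter v i with v i
... | +0       = pos i
... | +[1+ _ ] = pos i
... | -[1+ _ ] = neg i

-- Columns are numbered from zero: the first ∣ vᵢ ∣ of them are those with j < ∣ vᵢ ∣.
keyColumn : Vector ℤ n → ℕ → List (Letter n)
keyColumn {n} v j = sort (map (letter v) (filter (λ i → j ℕ.<? ∣ v i ∣) (allFin n)))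
  where open import Data.List.Sort (≼-decTotalOrder n) using (sort)

K : Vector ℤ n → Tableau n
K v = applyUpTo (keyColumn v) (Vector.foldr ℕ._⊔_ 0 (∣_∣ ∘ v))

addFullColumn : Tableau n → Tableau n
addFullColumn t = tabulate pos ∷ t

columnReading : Tableau n → List (Letter n)
columnReading t = concat (reverse t)

-- `deduplicate` keeps first occurrences.
readOnce : List (Letter n) → List (Letter n)
readOnce = deduplicate (λ x y → abs x Fin.≟ abs y)

{-# OPTIONS --safe #-}
-- A minimal σ has no descent inside its coset: if x ≼ y are letters on which λ
-- takes the same value and σ x ⋠ σ y, then the reflection exchanging x and y
-- stabilises λ, and by the exchange property its product with σ is shorter than σ.
-- Since v takes the value λᵢ at the letter (i)σ, the window lists the letters of v
-- by decreasing |vᵢ| and, for equal |vᵢ|, in the order of [±n]; where λᵢ = 0, the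
-- pair i, i̅ forces the letter (i)σ to be unbarred.  The reading word is the same
-- list: with the full column as column 0, column j contributes as new letters
-- those with |vᵢ| = j, in increasing order.
module Submission where

open import Defs
open import Data.Bool.Base using (true; false)
open import Data.Fin.Base as Fin using (Fin; zero; suc; inject₁; fromℕ)
import Data.Fin.Properties as Fin
open import Data.Fin.Permutation.Components using (transpose)
open import Data.Integer.Base as ℤ using (ℤ; 0ℤ; +0; +[1+_]; -[1+_]; ∣_∣)
import Data.Integer.Properties as ℤ
open import Data.List.Base
  using (List; []; _∷_; _++_; length; map; filter; allFin; concat; reverse; tabulate;
         applyUpTo; applyDownFrom; deduplicate)
open import Data.List.Membership.Propositional using (_∈_; find; lose)
open import Data.List.Membership.Propositional.Properties
  using (∈-++⁺ˡ; ∈-++⁺ʳ; ∈-filter⁺; ∈-filter⁻; ∈-map∘filter⁺; ∈-map∘filter⁻;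
         ∈-tabulate⁺; ∈-allFin; ∈-deduplicate⁻)
open import Data.List.Properties
  using (filter-all; filter-++; unfold-reverse; reverse-applyUpTo; concat-++;
         ++-assoc; ++-identityʳ)
open import Data.List.Relation.Binary.Permutation.Propositional using (↭-sym)
open import Data.List.Relation.Binary.Permutation.Propositional.Properties using (∈-resp-↭)
open import Data.List.Relation.Unary.All as All using (All; []; _∷_; all?)
import Data.List.Relation.Unary.All.Properties as All
open import Data.List.Relation.Unary.AllPairs as AllPairs using (AllPairs; []; _∷_)
import Data.List.Relation.Unary.AllPairs.Properties as AllPairs
open import Data.List.Relation.Unary.Any as Any using (Any; here; there)
import Data.List.Relation.Unary.Any.Properties as Any
import Data.List.Relation.Unary.Sorted.TotalOrder.Properties as Sorted
open import Data.Nat.Base as ℕ using (ℕ; zero; suc; _≥_; z≤n; s≤s)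
import Data.Nat.Properties as ℕ
open import Data.Product.Base using (_×_; _,_; proj₁; proj₂; ∃-syntax)
open import Data.Sum.Base using (_⊎_; inj₁; inj₂)
open import Data.Vec.Functional as Vector using (Vector)
open import Function.Base using (_∘_)
open import Level using (Level)
open import Relation.Binary.Bundles using (DecTotalOrder)
open import Relation.Binary.Core using (Rel)
open import Relation.Binary.Definitions using (Asymmetric; Decidable)
import Relation.Binary.Construct.NonStrictToStrict as ToStrict
open import Relation.Binary.PropositionalEquality
open import Relation.Nullary using (¬_; Dec; yes; no; does; contradiction)
open import Relation.Nullary.Decidable using (¬?)
open SignedPerm using (to; from; strictlyInverseˡ; strictlyInverseʳ; odd)

private
  variable
    a ℓ : Level
    A : Set a
    n : ℕ

-- Deduplication and strictly sorted lists

module _ {R : Rel A ℓ} (R? : Decidable R) where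

  filter-avoiding : ∀ x xs ys →
    filter (¬? ∘ R? x) (filter (λ y → all? (λ z → ¬? (R? z y)) xs) ys) ≡
    filter (λ y → all? (λ z → ¬? (R? z y)) (x ∷ xs)) ys
  filter-avoiding x xs []       = refl
  filter-avoiding x xs (y ∷ ys) with does (all? (λ z → ¬? (R? z y)) xs)
  ... | true  with does (R? x y)
  ...   | true  = filter-avoiding x xs ys
  ...   | false = cong (y ∷_) (filter-avoiding x xs ys)
  filter-avoiding x xs (y ∷ ys) | false with does (R? x y)
  ... | true  = filter-avoiding x xs ys
  ... | false = filter-avoiding x xs ys

  -- Lets a reading grow by one column at a time: the earlier part keeps its list, and only the
  -- second summand has to be studied.
  deduplicate-++ : ∀ xs ys → deduplicate R? (xs ++ ys) ≡
    deduplicate R? xs ++ filter (λ y → all? (λ x → ¬? (R? x y)) xs) (deduplicate R? ys)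
  deduplicate-++ []       ys = sym (filter-all _ (All.tabulate λ _ → []))
  deduplicate-++ (x ∷ xs) ys = cong (x ∷_) (begin
    filter (¬? ∘ R? x) (deduplicate R? (xs ++ ys))
      ≡⟨ cong (filter _) (deduplicate-++ xs ys) ⟩
    filter (¬? ∘ R? x) (deduplicate R? xs ++ filter _ (deduplicate R? ys))
      ≡⟨ filter-++ (¬? ∘ R? x) (deduplicate R? xs) _ ⟩
    filter (¬? ∘ R? x) (deduplicate R? xs) ++ filter (¬? ∘ R? x) (filter _ (deduplicate R? ys))
      ≡⟨ cong (filter _ (deduplicate R? xs) ++_) (filter-avoiding x xs (deduplicate R? ys)) ⟩
    filter (¬? ∘ R? x) (deduplicate R? xs) ++ filter _ (deduplicate R? ys)
      ∎)
    where open ≡-Reasoning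

  deduplicate-distinct : ∀ xs → AllPairs (λ x y → ¬ R x y) (deduplicate R? xs)
  deduplicate-distinct []       = []
  deduplicate-distinct (x ∷ xs) =
    All.all-filter _ (deduplicate R? xs) ∷ AllPairs.filter⁺ _ (deduplicate-distinct xs)

  AllPairs-deduplicate⁺ : ∀ {ℓ′} {S : Rel A ℓ′} {xs} →
                          AllPairs S xs → AllPairs S (deduplicate R? xs)
  AllPairs-deduplicate⁺ []         = []
  AllPairs-deduplicate⁺ (px ∷ pxs) =
    All.filter⁺ _ (All.deduplicate⁺ R? px) ∷ AllPairs.filter⁺ _ (AllPairs-deduplicate⁺ pxs)

AllPairs-restrict : ∀ {p} {P : A → Set p} {R : Rel A ℓ} {xs} → All P xs → AllPairs R xs →
                    AllPairs (λ x y → P x × P y × R x y) xs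
AllPairs-restrict []         []         = []
AllPairs-restrict (px ∷ pxs) (rx ∷ rxs) =
  All.map (λ (py , r) → px , py , r) (All.zip (pxs , rx)) ∷ AllPairs-restrict pxs rxs

-- If the heads differed, each would occur in the tail of the other list and so be both above and
-- below the other head. Asymmetry also keeps a head out of its own tail, so both inclusions pass to
-- the tails.
strictlySorted-unique : {_<_ : Rel A ℓ} → Asymmetric _<_ → ∀ {xs ys} →
  AllPairs _<_ xs → AllPairs _<_ ys →
  (∀ {z} → z ∈ xs → z ∈ ys) → (∀ {z} → z ∈ ys → z ∈ xs) → xs ≡ ys
strictlySorted-unique asym {[]}     {[]}     _ _ _ _ = refl
strictlySorted-unique asym {[]}     {y ∷ ys} _ _ _ g = contradiction (g (here refl)) λ ()
strictlySorted-unique asym {x ∷ xs} {[]}     _ _ f _ = contradiction (f (here refl)) λ ()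
strictlySorted-unique {A = A} {_<_ = _<_} asym {x ∷ xs} {y ∷ ys} (x<xs ∷ xs<) (y<ys ∷ ys<) f g =
  cong₂ _∷_ x≡y
    (strictlySorted-unique asym xs< ys<
      (λ z∈xs → tail-⊆ x<xs x≡y z∈xs (f (there z∈xs)))
      (λ z∈ys → tail-⊆ y<ys (sym x≡y) z∈ys (g (there z∈ys))))
  where
  x≡y : x ≡ y
  x≡y with f (here refl) | g (here refl)
  ... | here eq    | _          = eq
  ... | there _    | here eq    = sym eq
  ... | there x∈ys | there y∈xs =
    contradiction (All.lookup y<ys x∈ys) (asym (All.lookup x<xs y∈xs))

  tail-⊆ : ∀ {x y us ws} → All (x <_) us → x ≡ y → {z : A} → z ∈ us → z ∈ y ∷ ws → z ∈ ws
  tail-⊆ x<us refl z∈us (here refl) =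
    contradiction (All.lookup x<us z∈us) (asym (All.lookup x<us z∈us))
  tail-⊆ x<us refl z∈us (there z∈ws) = z∈ws

-- Reflections and the exchange property

to-injective : (σ : SignedPerm n) {x y : Letter n} → to σ x ≡ to σ y → x ≡ y
to-injective σ {x} {y} eq =
  trans (sym (strictlyInverseʳ σ x)) (trans (cong (from σ) eq) (strictlyInverseʳ σ y))

-- The graph of the reflection exchanging x with y and x̅ with y̅; for y = x̅ it
-- only exchanges x and x̅.
data Reflects (x y : Letter n) : Letter n → Letter n → Set where
  left     : Reflects x y x y
  right    : Reflects x y y x
  barLeft  : Reflects x y (bar x) (bar y)
  barRight : Reflects x y (bar y) (bar x)
  fixed    : ∀ {z} → z ≢ x → z ≢ y → z ≢ bar x → z ≢ bar y → Reflects x y z z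

reflects-total : (x y z : Letter n) → ∃[ z′ ] Reflects x y z z′
reflects-total x y z with z ≟ x | z ≟ y | z ≟ bar x | z ≟ bar y
... | yes refl | _        | _        | _        = _ , left
... | no _     | yes refl | _        | _        = _ , right
... | no _     | no _     | yes refl | _        = _ , barLeft
... | no _     | no _     | no _     | yes refl = _ , barRight
... | no p     | no q     | no r     | no t     = _ , fixed p q r t

reflects-sym : {x y z z′ : Letter n} → Reflects x y z z′ → Reflects x y z′ z
reflects-sym left            = right
reflects-sym right           = left
reflects-sym barLeft         = barRight
reflects-sym barRight        = barLeft
reflects-sym (fixed p q r t) = fixed p q r t

-- Conjugating a reflection by `σ` gives the reflection in the images of its two letters. This lets
-- `exchange` move a reflection past the first generator of a word.
reflects-map : (σ : SignedPerm n) {x y z z′ : Letter n} → Reflects x y z z′ →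
               Reflects (to σ x) (to σ y) (to σ z) (to σ z′)
reflects-map σ left  = left
reflects-map σ right = right
reflects-map σ {x} {y} barLeft  rewrite odd σ x | odd σ y = barLeft
reflects-map σ {x} {y} barRight rewrite odd σ x | odd σ y = barRight
reflects-map σ {x} {y} (fixed p q r t) =
  fixed (p ∘ to-injective σ) (q ∘ to-injective σ)
        (r ∘ to-injective σ ∘ λ eq → trans eq (sym (odd σ x)))
        (t ∘ to-injective σ ∘ λ eq → trans eq (sym (odd σ y)))

-- `entry v` is odd, so equal values at `x` and `y` give equal values at their bars; hence the
-- reflection stabilises `v`.
reflects-entry : (v : Vector ℤ n) {x y z z′ : Letter n} → entry v x ≡ entry v y →
                 Reflects x y z z′ → entry v z ≡ entry v z′
reflects-entry v eq left  = eq
reflects-entry v eq right = sym eq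
reflects-entry v {x} {y} eq barLeft =
  trans (entry-bar v x) (trans (cong ℤ.-_ eq) (sym (entry-bar v y)))
reflects-entry v {x} {y} eq barRight =
  trans (entry-bar v y) (trans (cong ℤ.-_ (sym eq)) (sym (entry-bar v x)))
reflects-entry v eq (fixed _ _ _ _) = refl

reflects⇒to : (σ : SignedPerm n) {x y : Letter n} → to σ x ≡ y → to σ y ≡ x →
  (∀ {z} → z ≢ x → z ≢ y → z ≢ bar x → z ≢ bar y → to σ z ≡ z) →
  ∀ {z z′} → Reflects x y z z′ → to σ z ≡ z′
reflects⇒to σ xy yx fix left            = xy
reflects⇒to σ xy yx fix right           = yx
reflects⇒to σ {x} xy yx fix barLeft     = trans (odd σ x) (cong bar xy)
reflects⇒to σ {y = y} xy yx fix barRight = trans (odd σ y) (cong bar yx)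
reflects⇒to σ xy yx fix (fixed p q r t) = fix p q r t

-- Inversions of the generators

data TransposeView (i j : Fin n) : Fin n → Fin n → Set where
  first  : TransposeView i j i j
  second : TransposeView i j j i
  other  : ∀ {k} → k ≢ i → k ≢ j → TransposeView i j k k

transposeView : (i j k : Fin n) → TransposeView i j k (transpose i j k)
transposeView i j k with k Fin.≟ i
... | yes refl = first
... | no k≢i with k Fin.≟ j
...   | yes refl = second
...   | no k≢j   = other k≢i k≢j

transpose-first : (i j : Fin n) → transpose i j i ≡ j
transpose-first i j with transpose i j i | transposeView i j i
... | _ | first     = refl
... | _ | second    = refl
... | _ | other p _ = contradiction refl p

transpose-second : (i j : Fin n) → transpose i j j ≡ i
transpose-second i j with transpose i j j | transposeView i j j
... | _ | first     = refl
... | _ | second    = refl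
... | _ | other _ p = contradiction refl p

transpose-other : {i j k : Fin n} → k ≢ i → k ≢ j → transpose i j k ≡ k
transpose-other {i = i} {j} {k} p q with transpose i j k | transposeView i j k
... | _ | first     = contradiction refl p
... | _ | second    = contradiction refl q
... | _ | other _ _ = refl

≤∧≢⇒suc≤ : {p : Fin n} {b : Fin (suc n)} →
               inject₁ p Fin.≤ b → b ≢ inject₁ p → suc p Fin.≤ b
≤∧≢⇒suc≤ {p = p} {b} p≤b b≢p =
  subst (ℕ._< Fin.toℕ b) (Fin.toℕ-inject₁ p)
        (ℕ.≤∧≢⇒< p≤b (b≢p ∘ Fin.toℕ-injective ∘ sym))

≤∧≢⇒≤inject₁ : {p : Fin n} {b : Fin (suc n)} →
               b Fin.≤ suc p → b ≢ suc p → b Fin.≤ inject₁ p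
≤∧≢⇒≤inject₁ {p = p} {b} b≤p b≢p =
  subst (Fin.toℕ b ℕ.≤_) (sym (Fin.toℕ-inject₁ p))
        (ℕ.≤-pred (ℕ.≤∧≢⇒< b≤p (b≢p ∘ Fin.toℕ-injective)))

inject₁≤suc : (p : Fin n) → inject₁ p Fin.≤ Fin.suc p
inject₁≤suc p = subst (ℕ._≤ suc (Fin.toℕ p)) (sym (Fin.toℕ-inject₁ p)) (ℕ.n≤1+n _)

-- The two exchanged values are neighbours, so any third value lies above both or below both.
transpose-mono : (p : Fin n) {b c : Fin (suc n)} → b Fin.≤ c →
  transpose (inject₁ p) (suc p) b Fin.≤ transpose (inject₁ p) (suc p) c ⊎
  (b ≡ inject₁ p × c ≡ suc p)
transpose-mono p {b} {c} b≤c
  with transpose (inject₁ p) (suc p) b | transposeView (inject₁ p) (suc p) b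
     | transpose (inject₁ p) (suc p) c | transposeView (inject₁ p) (suc p) c
... | _ | first     | _ | first     = inj₁ ℕ.≤-refl
... | _ | first     | _ | second    = inj₂ (refl , refl)
... | _ | first     | _ | other q _ = inj₁ (≤∧≢⇒suc≤ b≤c q)
... | _ | second    | _ | first     = inj₁ (inject₁≤suc p)
... | _ | second    | _ | second    = inj₁ (ℕ.≤-refl {Fin.toℕ (inject₁ p)})
... | _ | second    | _ | other _ _ = inj₁ (ℕ.≤-trans (inject₁≤suc p) b≤c)
... | _ | other _ _ | _ | first     = inj₁ (ℕ.≤-trans b≤c (inject₁≤suc p))
... | _ | other _ q | _ | second    = inj₁ (≤∧≢⇒≤inject₁ b≤c q)
... | _ | other _ _ | _ | other _ _ = inj₁ b≤c

-- In terms of roots: a simple reflection makes only its own positive root negative. An adjacent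
-- generator reverses only the pair that it swaps or the barred copy of it, and `final` only the
-- last unbarred letter and its bar; the generator is then the reflection in that pair.
s-inversion : (g : Generator n) {x y : Letter n} → x ≼ y → ¬ (to (s g) x ≼ to (s g) y) →
              ∀ {z z′} → Reflects x y z z′ → to (s g) z ≡ z′
s-inversion (adjacent p) (pos≼pos b≤c) ¬q with transpose-mono p b≤c
... | inj₁ q = contradiction (pos≼pos q) ¬q
... | inj₂ (refl , refl) =
  reflects⇒to (s (adjacent p)) (cong pos (transpose-first (inject₁ p) (suc p)))
              (cong pos (transpose-second (inject₁ p) (suc p)))
    λ { {pos k} q r _ _ → cong pos (transpose-other (q ∘ cong pos) (r ∘ cong pos))
      ; {neg k} _ _ q r → cong neg (transpose-other (q ∘ cong neg) (r ∘ cong neg)) }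
s-inversion (adjacent p) pos≼neg ¬q = contradiction pos≼neg ¬q
s-inversion (adjacent p) (neg≼neg b≤c) ¬q with transpose-mono p b≤c
... | inj₁ q = contradiction (neg≼neg q) ¬q
... | inj₂ (refl , refl) =
  reflects⇒to (s (adjacent p)) (cong neg (transpose-second (inject₁ p) (suc p)))
              (cong neg (transpose-first (inject₁ p) (suc p)))
    λ { {pos k} _ _ q r → cong pos (transpose-other (r ∘ cong pos) (q ∘ cong pos))
      ; {neg k} q r _ _ → cong neg (transpose-other (r ∘ cong neg) (q ∘ cong neg)) }
s-inversion {suc m} final {pos b} {pos c} (pos≼pos b≤c) ¬q
  with b Fin.≟ fromℕ m | c Fin.≟ fromℕ m
... | yes refl | yes refl = contradiction (neg≼neg ℕ.≤-refl) ¬q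
... | yes refl | no c≢m   = contradiction (Fin.≤-antisym (Fin.≤fromℕ c) b≤c) c≢m
... | no _     | yes refl = contradiction pos≼neg ¬q
... | no _     | no _     = contradiction (pos≼pos b≤c) ¬q
s-inversion {suc m} final {pos b} {neg c} pos≼neg ¬q
  with b Fin.≟ fromℕ m in eqb | c Fin.≟ fromℕ m
... | yes refl | no _     = contradiction (neg≼neg (Fin.≤fromℕ c)) ¬q
... | no _     | yes refl = contradiction (pos≼pos (Fin.≤fromℕ b)) ¬q
... | no _     | no _     = contradiction pos≼neg ¬q
... | yes refl | yes refl = reflects⇒to (s final) flip-pos flip-neg fix
  where
  flip-pos : flipAt (fromℕ m) (pos (fromℕ m)) ≡ neg (fromℕ m)
  flip-pos rewrite eqb = refl
  flip-neg : flipAt (fromℕ m) (neg (fromℕ m)) ≡ pos (fromℕ m)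
  flip-neg rewrite eqb = refl
  fix : ∀ {z} → z ≢ pos (fromℕ m) → z ≢ neg (fromℕ m) → z ≢ neg (fromℕ m) →
        z ≢ pos (fromℕ m) → flipAt (fromℕ m) z ≡ z
  fix {pos k} p q _ _ with k Fin.≟ fromℕ m
  ... | yes refl = contradiction refl p
  ... | no _     = refl
  fix {neg k} p q _ _ with k Fin.≟ fromℕ m
  ... | yes refl = contradiction refl q
  ... | no _     = refl
s-inversion {suc m} final {neg b} {neg c} (neg≼neg c≤b) ¬q
  with b Fin.≟ fromℕ m | c Fin.≟ fromℕ m
... | yes refl | yes refl = contradiction (pos≼pos ℕ.≤-refl) ¬q
... | yes refl | no _     = contradiction pos≼neg ¬q
... | no b≢m   | yes refl = contradiction (Fin.≤-antisym (Fin.≤fromℕ b) c≤b) b≢m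
... | no _     | no _     = contradiction (neg≼neg c≤b) ¬q

-- The deleted letter is the one at which the images of x and y change their order.
exchange : (w : List (Generator n)) {x y : Letter n} → x ≼ y →
  ¬ (to (evaluate w) x ≼ to (evaluate w) y) →
  ∃[ w′ ] length w′ ℕ.< length w ×
          (∀ {z z′} → Reflects x y z z′ → to (evaluate w′) z ≡ to (evaluate w) z′)
exchange []      x≼y inv = contradiction x≼y inv
exchange (g ∷ w) {x} {y} x≼y inv with to (s g) x ≼? to (s g) y
... | yes sx≼sy with exchange w sx≼sy inv
...   | w′ , shorter , eq = g ∷ w′ , s≤s shorter , eq ∘ reflects-map (s g)
exchange (g ∷ w) {x} {y} x≼y inv | no sx⋠sy =
  w , ℕ.n<1+n _ , λ r → cong (to (evaluate w)) (sym (s-inversion g x≼y sx⋠sy (reflects-sym r)))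

-- Minimal coset representatives

module _ {u v : Vector ℤ n} (σ : SignedPerm n) where

  -- Trades `from`, in which the action is defined, for `to`, in which `exchange` describes the new
  -- word; `entry⇒·` goes back.
  ·⇒entry : u · σ ≗ v → ∀ x → entry v (to σ x) ≡ entry u x
  ·⇒entry eq x = trans (sym (entry-≗ (to σ x)))
    (trans (entry-· u σ (to σ x)) (cong (entry u) (strictlyInverseʳ σ x)))
    where
    entry-≗ : ∀ y → entry (u · σ) y ≡ entry v y
    entry-≗ (pos i) = eq i
    entry-≗ (neg i) = cong ℤ.-_ (eq i)

  entry⇒· : (∀ x → entry v (to σ x) ≡ entry u x) → u · σ ≗ v
  entry⇒· eq i = trans (sym (eq (from σ (pos i)))) (cong (entry v) (strictlyInverseˡ σ (pos i)))

module _ {u v : Vector ℤ n} where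

  -- The minimality hypothesis only compares with elements whose length is given, while a word need
  -- not be reduced. Strong induction on the length of the word, bounded by `b` in `go`, closes the
  -- gap.
  minimal≤length : ∀ {k} → (∀ τ l → u · τ ≗ v → HasLength τ l → k ℕ.≤ l) →
                   ∀ w → u · evaluate w ≗ v → k ℕ.≤ length w
  minimal≤length {k} minimal w = go (suc (length w)) w (ℕ.n<1+n _)
    where
    go : ∀ b w → length w ℕ.< b → u · evaluate w ≗ v → k ℕ.≤ length w
    go (suc b) w (s≤s len≤b) eq with k ℕ.≤? length w
    ... | yes k≤len = k≤len
    -- A word shorter than `k` would have to be reduced, as a still shorter word for the same
    -- element has length at least `k` by induction. Its length is then that of the element, and
    -- `minimal` applies.
    ... | no  k≰len = minimal (evaluate w) (length w) eq ((w , refl , λ _ → refl) , shortest)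
      where
      shortest : ∀ w′ → evaluate w′ ≈ evaluate w → length w ℕ.≤ length w′
      shortest w′ w′≈w = ℕ.≮⇒≥ λ shorter → k≰len
        (ℕ.≤-trans (go b w′ (ℕ.<-≤-trans shorter len≤b)
                      (entry⇒· (evaluate w′) λ x →
                        trans (cong (entry v) (w′≈w x)) (·⇒entry (evaluate w) eq x)))
                   (ℕ.<⇒≤ shorter))

  minimal⇒mono : ∀ {σ} → IsMinimalRepresentative u v σ →
                 ∀ {x y} → x ≼ y → entry u x ≡ entry u y → to σ x ≼ to σ y
  minimal⇒mono {σ} (eq , k , ((w , refl , w≈σ) , _) , minimal) {x} {y} x≼y ux≡uy
    with to σ x ≼? to σ y
  ... | yes p = p
  ... | no ¬p with exchange w x≼y (¬p ∘ subst₂ _≼_ (w≈σ x) (w≈σ y))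
  ...   | w′ , shorter , w′-spec =
    contradiction (minimal≤length minimal w′ (entry⇒· (evaluate w′) w′-entry)) (ℕ.<⇒≱ shorter)
    where
    -- The reflection stabilises `u`, so the shorter word still carries `u` to `v`.
    w′-entry : ∀ z → entry v (to (evaluate w′) z) ≡ entry u z
    w′-entry z with reflects-total x y z
    ... | z′ , r = begin
      entry v (to (evaluate w′) z) ≡⟨ cong (entry v) (w′-spec r) ⟩
      entry v (to (evaluate w) z′) ≡⟨ cong (entry v) (w≈σ z′) ⟩
      entry v (to σ z′)            ≡⟨ ·⇒entry σ eq z′ ⟩
      entry u z′                   ≡⟨ reflects-entry u ux≡uy r ⟨
      entry u z                    ∎
      where open ≡-Reasoning

-- The letters of v in order of decreasing absolute value

abs-letter : (v : Vector ℤ n) (i : Fin n) → abs (letter v i) ≡ i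
abs-letter v i with v i
... | +0       = refl
... | +[1+ _ ] = refl
... | -[1+ _ ] = refl

-- A nonzero value fixes the sign of the letter. A zero value does not, and there `x ≼ bar x`
-- selects the unbarred letter.
≡letter : (v : Vector ℤ n) (x : Letter n) → 0ℤ ℤ.≤ entry v x →
          (entry v x ≡ 0ℤ → x ≼ bar x) → x ≡ letter v (abs x)
≡letter v (pos i) 0≤ _ with v i | 0≤
... | +0       | _ = refl
... | +[1+ _ ] | _ = refl
≡letter v (neg i) 0≤ small with v i | 0≤ | small
... | +0       | _ | small′ = contradiction (small′ refl) λ ()
... | -[1+ _ ] | _ | _      = refl

-- Here the default of `letter` at zero matters: it is the letter that the full column supplies.
pos≡letter : (v : Vector ℤ n) (i : Fin n) → ∣ v i ∣ ≡ 0 → pos i ≡ letter v i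
pos≡letter v i eq with v i | eq
... | +0 | _ = refl

∣entry∣ : (v : Vector ℤ n) (x : Letter n) → ∣ entry v x ∣ ≡ ∣ v (abs x) ∣
∣entry∣ v (pos i) = refl
∣entry∣ v (neg i) = ℤ.∣-i∣≡∣i∣ (v i)

module _ (v : Vector ℤ n) where

  size : Letter n → ℕ
  size x = ∣ v (abs x) ∣

  infix 4 _⊑_
  _⊑_ : Letter n → Letter n → Set
  x ⊑ y = size y ℕ.< size x ⊎ (size x ≡ size y × x ≼ y)

  ⊑-antisym : ∀ {x y} → x ⊑ y → y ⊑ x → x ≡ y
  ⊑-antisym (inj₁ p)       (inj₁ q)       = contradiction p (ℕ.<-asym q)
  ⊑-antisym (inj₁ p)       (inj₂ (q , _)) = contradiction q (ℕ.<⇒≢ p)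
  ⊑-antisym (inj₂ (p , _)) (inj₁ q)       = contradiction p (ℕ.<⇒≢ q)
  ⊑-antisym (inj₂ (_ , p)) (inj₂ (_ , q)) = ≼-antisym p q

  -- The invariant of the reading from right to left: `k` is the number of the last column read, the
  -- full column being number 0. As `_⊑_` is reflexive, distinctness is a separate matter.
  record ListsLettersFrom (k : ℕ) (xs : List (Letter n)) : Set where
    field
      sorted   : AllPairs _⊑_ xs
      sound    : All (λ x → x ≡ letter v (abs x) × k ℕ.≤ size x) xs
      complete : ∀ i → k ℕ.≤ ∣ v i ∣ → letter v i ∈ xs

  open ListsLettersFrom

  -- Distinctness makes the sorting strict, and soundness with completeness gives both lists the
  -- same members.
  lists-unique : ∀ {k xs ys} → ListsLettersFrom k xs → ListsLettersFrom k ys →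
                 AllPairs _≢_ xs → AllPairs _≢_ ys → xs ≡ ys
  lists-unique {k} X Y xs! ys! =
    strictlySorted-unique (ToStrict.<-asym _≡_ _⊑_ ⊑-antisym)
      (AllPairs.zip (sorted X , xs!)) (AllPairs.zip (sorted Y , ys!)) (⊆ X Y) (⊆ Y X)
    where
    ⊆ : ∀ {xs ys} → ListsLettersFrom k xs → ListsLettersFrom k ys → ∀ {z} → z ∈ xs → z ∈ ys
    ⊆ X Y z∈xs with All.lookup (sound X) z∈xs
    ... | z≡ , k≤ = subst (_∈ _) (sym z≡) (complete Y _ k≤)

  -- Common to the key columns and the full column. In the full column an entry of positive size may
  -- have the wrong sign, but its absolute value has been read before; so signs are prescribed only
  -- at size `k`, and `covering` speaks of absolute values.
  record IsColumn (k : ℕ) (xs : List (Letter n)) : Set where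
    field
      increasing : AllPairs _≼_ xs
      large      : All (λ x → k ℕ.≤ size x) xs
      minimum    : All (λ x → size x ≡ k → x ≡ letter v (abs x)) xs
      covering   : ∀ i → k ℕ.≤ ∣ v i ∣ → Any (λ x → abs x ≡ i) xs

  -- An entry of `ys` of size above `k` repeats an absolute value from `xs`, where all of these
  -- occur. One of size `k` is new relative to `xs`, which has only larger sizes.
  readOnce-++ : ∀ {k xs ys} → ListsLettersFrom (suc k) (readOnce xs) → IsColumn k ys →
                ListsLettersFrom k (readOnce (xs ++ ys))
  readOnce-++ {k} {xs} {ys} X Y
    rewrite deduplicate-++ (λ x y → abs x Fin.≟ abs y) xs ys = record
    { sorted = AllPairs.++⁺ (sorted X)
        (AllPairs.map (λ ((p , _) , (q , _) , x≼y) → inj₂ (trans p (sym q) , x≼y))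
          (AllPairs-restrict new-spec
            (AllPairs.filter⁺ _ (AllPairs-deduplicate⁺ _ (IsColumn.increasing Y)))))
        (All.map (λ (_ , k<) → All.map (λ (p , _) → inj₁ (subst (ℕ._< _) (sym p) k<)) new-spec)
                 (sound X))
    ; sound = All.++⁺ (All.map (λ (p , k<) → p , ℕ.<⇒≤ k<) (sound X))
                      (All.map (λ (p , q) → q , ℕ.≤-reflexive (sym p)) new-spec)
    ; complete = complete′
    }
    where
    fresh? = λ y → all? (λ x → ¬? (abs x Fin.≟ abs y)) xs
    new = filter fresh? (readOnce ys)

    -- Size depends only on the absolute value, so the bound passes from first occurrences back to
    -- all of `xs`.
    xs-large : All (λ x → k ℕ.< size x) xs
    xs-large = All.deduplicate⁻ _
      (λ eq → subst (λ i → k ℕ.< ∣ v i ∣) eq) xs (All.map proj₂ (sound X))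

    new-spec : All (λ x → size x ≡ k × x ≡ letter v (abs x)) new
    new-spec = All.tabulate λ {y} y∈new →
      let y∈ , fresh = ∈-filter⁻ fresh? {xs = readOnce ys} y∈new
          y∈ys = ∈-deduplicate⁻ _ ys y∈
          size≯k = λ k< → All.lookup fresh (∈-deduplicate⁻ _ xs (complete X (abs y) k<))
                                     (abs-letter v (abs y))
          size≡k = ℕ.≤-antisym (ℕ.≮⇒≥ size≯k) (All.lookup (IsColumn.large Y) y∈ys)
      in size≡k , All.lookup (IsColumn.minimum Y) y∈ys size≡k

    complete′ : ∀ i → k ℕ.≤ ∣ v i ∣ → letter v i ∈ readOnce xs ++ new
    complete′ i k≤ with suc k ℕ.≤? ∣ v i ∣
    ... | yes k< = ∈-++⁺ˡ (complete X i k<)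
    ... | no  k≮ = ∈-++⁺ʳ (readOnce xs) (subst (_∈ new) y≡ (∈-filter⁺ fresh? y∈ fresh))
      where
      found = find (Any.deduplicate⁺ (λ x y → abs x Fin.≟ abs y) (λ p q → trans p q)
                                     (IsColumn.covering Y i k≤))
      y = proj₁ found
      y∈ = proj₁ (proj₂ found)
      abs-y = proj₂ (proj₂ found)
      size-y : size y ≡ k
      size-y = trans (cong (∣_∣ ∘ v) abs-y) (ℕ.≤-antisym (ℕ.≮⇒≥ k≮) k≤)
      -- `covering` gave only the absolute value; as the size is `k`, `minimum` fixes the sign.
      y≡ : y ≡ letter v i
      y≡ = trans (All.lookup (IsColumn.minimum Y) (∈-deduplicate⁻ _ ys y∈) size-y) (cong (letter v) abs-y)
      fresh : All (λ x → abs x ≢ abs y) xs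
      fresh = All.map (λ k< eq → ℕ.<-irrefl (sym (trans (cong (∣_∣ ∘ v) eq) size-y)) k<) xs-large

  -- Key columns are counted from zero, so each number rises by one when the full column takes
  -- number 0.
  keyColumn-isColumn : ∀ j → IsColumn (suc j) (keyColumn v j)
  keyColumn-isColumn j = record
    { increasing = Sorted.Sorted⇒AllPairs totalOrder (sort-↗ _)
    ; large      = All.tabulate λ x∈ → proj₁ (letters-spec (∈-resp-↭ (sort-↭ _) x∈))
    ; minimum    = All.tabulate λ x∈ _ → proj₂ (letters-spec (∈-resp-↭ (sort-↭ _) x∈))
    ; covering   = λ i j< → lose
        (∈-resp-↭ (↭-sym (sort-↭ _)) (∈-map∘filter⁺ (letter v) large? (i , ∈-allFin i , refl , j<)))
        (abs-letter v i)
    }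
    where
    open DecTotalOrder (≼-decTotalOrder n) using (totalOrder)
    open import Data.List.Sort (≼-decTotalOrder n) using (sort-↗; sort-↭)
    large? : (i : Fin n) → Dec (j ℕ.< ∣ v i ∣)
    large? i = j ℕ.<? ∣ v i ∣
    letters = map (letter v) (filter large? (allFin n))

    letters-spec : ∀ {x} → x ∈ letters → j ℕ.< size x × x ≡ letter v (abs x)
    letters-spec {x} x∈ =
      let i , _ , x≡ , j< = ∈-map∘filter⁻ (letter v) large? {xs = allFin n} x∈
          i≡ = sym (trans (cong abs x≡) (abs-letter v i))
      in subst (λ i → j ℕ.< ∣ v i ∣) i≡ j< , trans x≡ (cong (letter v) i≡)

  fullColumn-isColumn : IsColumn 0 (tabulate pos)
  fullColumn-isColumn = record
    { increasing = AllPairs.tabulate⁺-< (pos≼pos ∘ ℕ.<⇒≤)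
    ; large      = All.tabulate⁺ λ _ → z≤n
    ; minimum    = All.tabulate⁺ (pos≡letter v)
    ; covering   = λ i _ → Any.tabulate⁺ i refl
    }

  -- `xs` accumulates the part already read; key columns `m - 1` down to 0 and the full column
  -- remain. Key column `m - 1` has number `m` in the invariant, whence `suc m` for `xs`.
  columns-list : ∀ m {xs} → ListsLettersFrom (suc m) (readOnce xs) →
    ListsLettersFrom 0 (readOnce (xs ++ concat (applyDownFrom (keyColumn v) m) ++ tabulate pos))
  columns-list zero    X = readOnce-++ X fullColumn-isColumn
  columns-list (suc m) {xs} X = subst (ListsLettersFrom 0 ∘ readOnce) reassociate
    (columns-list m (readOnce-++ X (keyColumn-isColumn m)))
    where
    rest = concat (applyDownFrom (keyColumn v) m)
    reassociate : (xs ++ keyColumn v m) ++ rest ++ tabulate pos ≡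
                  xs ++ (keyColumn v m ++ rest) ++ tabulate pos
    reassociate = trans (++-assoc xs _ _)
      (cong (xs ++_) (sym (++-assoc (keyColumn v m) rest (tabulate pos))))

-- The reading word of the whole tableau

≤foldr-⊔ : (f : Vector ℕ n) (i : Fin n) → f i ℕ.≤ Vector.foldr ℕ._⊔_ 0 f
≤foldr-⊔ f zero    = ℕ.m≤m⊔n _ _
≤foldr-⊔ f (suc i) = ℕ.≤-trans (≤foldr-⊔ (f ∘ suc) i) (ℕ.m≤n⊔m _ _)

columnReading-addFullColumn : (f : ℕ → List (Letter n)) (m : ℕ) →
  columnReading (addFullColumn (applyUpTo f m)) ≡ concat (applyDownFrom f m) ++ tabulate pos
columnReading-addFullColumn f m = begin
  concat (reverse (tabulate pos ∷ applyUpTo f m))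
    ≡⟨ cong concat (unfold-reverse (tabulate pos) (applyUpTo f m)) ⟩
  concat (reverse (applyUpTo f m) ++ tabulate pos ∷ [])
    ≡⟨ cong (λ cs → concat (cs ++ tabulate pos ∷ [])) (reverse-applyUpTo f m) ⟩
  concat (applyDownFrom f m ++ tabulate pos ∷ [])
    ≡⟨ concat-++ (applyDownFrom f m) _ ⟨
  concat (applyDownFrom f m) ++ tabulate pos ++ []
    ≡⟨ cong (concat (applyDownFrom f m) ++_) (++-identityʳ (tabulate pos)) ⟩
  concat (applyDownFrom f m) ++ tabulate pos
    ∎
  where open ≡-Reasoning

readOnce-lists : (v : Vector ℤ n) →
  ListsLettersFrom v 0 (readOnce (columnReading (addFullColumn (K v))))
readOnce-lists v = subst (ListsLettersFrom v 0 ∘ readOnce)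
  (sym (columnReading-addFullColumn (keyColumn v) max))
  (columns-list v max {[]} record
    { sorted   = []
    ; sound    = []
    -- No coordinate exceeds the maximum, so before the first column there is nothing to list.
    ; complete = λ i max< → contradiction (≤foldr-⊔ (∣_∣ ∘ v) i) (ℕ.<⇒≱ max<)
    })
  where max = Vector.foldr ℕ._⊔_ 0 (∣_∣ ∘ v)

-- The window of a minimal representative

module _ {lam v : Vector ℤ n} (partition : IsPartition lam) (σ : SignedPerm n)
         (minimal : IsMinimalRepresentative lam v σ) where

  open IsPartition partition

  value : ∀ i → entry v (to σ (pos i)) ≡ lam i
  value i = ·⇒entry σ (proj₁ minimal) (pos i)

  window-letter : ∀ i → to σ (pos i) ≡ letter v (abs (to σ (pos i)))
  window-letter i = ≡letter v (to σ (pos i)) (subst (0ℤ ℤ.≤_) (sym (value i)) (nonNegative i))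
    λ value≡0 → subst (to σ (pos i) ≼_) (odd σ (pos i))
      (minimal⇒mono {σ = σ} minimal pos≼neg
        (zero≡neg (trans (sym (value i)) value≡0)))
    where
    zero≡neg : ∀ {a} → a ≡ 0ℤ → a ≡ ℤ.- a
    zero≡neg refl = refl

  size-window : ∀ i → size v (to σ (pos i)) ≡ ∣ lam i ∣
  size-window i = trans (sym (∣entry∣ v (to σ (pos i)))) (cong ∣_∣ (value i))

  window-⊑ : ∀ {i j} → i Fin.< j → _⊑_ v (to σ (pos i)) (to σ (pos j))
  window-⊑ {i} {j} i<j rewrite size-window i | size-window j with ∣ lam i ∣ ℕ.≟ ∣ lam j ∣
  ... | no  ≢ = inj₁ (ℕ.≤∧≢⇒< (ℤ.drop‿+≤+ (subst₂ ℤ._≤_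
                  (sym (ℤ.0≤i⇒+∣i∣≡i (nonNegative j))) (sym (ℤ.0≤i⇒+∣i∣≡i (nonNegative i)))
                  (decreasing (ℕ.<⇒≤ i<j)))) (≢ ∘ sym))
  -- Parts are nonnegative, so equal absolute values are equal values and minimality preserves the
  -- order.
  ... | yes ≡ = inj₂ (≡ , minimal⇒mono {σ = σ} minimal (pos≼pos (ℕ.<⇒≤ i<j))
                  (trans (sym (ℤ.0≤i⇒+∣i∣≡i (nonNegative i)))
                    (trans (cong ℤ.+_ ≡) (ℤ.0≤i⇒+∣i∣≡i (nonNegative j)))))

  -- Covers barred letters because completeness applies it to the preimage of `pos i`, which may be
  -- barred; this leaves the absolute value of the image unchanged.
  letter∈window : ∀ x → letter v (abs (to σ x)) ∈ window σ
  letter∈window (pos j) = subst (_∈ window σ) (window-letter j) (∈-tabulate⁺ j)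
  letter∈window (neg j) = subst (λ i → letter v i ∈ window σ)
    (sym (trans (cong abs (odd σ (pos j))) (abs-bar (to σ (pos j))))) (letter∈window (pos j))
    where
    abs-bar : ∀ x → abs (bar x) ≡ abs x
    abs-bar (pos _) = refl
    abs-bar (neg _) = refl

  window-lists : ListsLettersFrom v 0 (window σ)
  window-lists = record
    { sorted   = AllPairs.tabulate⁺-< window-⊑
    ; sound    = All.tabulate⁺ λ i → window-letter i , z≤n
    ; complete = λ i _ → subst (λ x → letter v (abs x) ∈ window σ)
                   (strictlyInverseˡ σ (pos i)) (letter∈window (from σ (pos i)))
    }

  window-distinct : AllPairs _≢_ (window σ)
  window-distinct = AllPairs.tabulate⁺ λ i≢j eq → i≢j (pos-injective (to-injective σ eq))
    where
    pos-injective : ∀ {i j : Fin n} → pos i ≡ pos j → i ≡ j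
    pos-injective refl = refl

proposition5 : (n : ℕ) → n ≥ 1 →
    (lam v : Vector ℤ n) → IsPartition lam → InOrbit lam v →
    (σᵥ : SignedPerm n) → IsMinimalRepresentative lam v σᵥ →
    window σᵥ ≡ readOnce (columnReading (addFullColumn (K v)))
proposition5 n _ lam v partition _ σᵥ minimal =
  lists-unique v (window-lists partition σᵥ minimal) (readOnce-lists v)
    (window-distinct partition σᵥ minimal)
    (AllPairs.map (λ abs≢ eq → abs≢ (cong abs eq)) (deduplicate-distinct _ _))
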